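{- Let $\mathcal{U}$ be a universe. Then $\mathcal{U}$ contains a $\mathcal{U}$-invertible element of formal birthday $1$ if and only if at least one of the following holds: (i) no Left end in $\mathcal{U}$ is a starkiller; or (ii) $1\in\mathcal{U}$ and no Left end in $\mathcal{U}$ is a disintegrator.
   Context: Games are short partizan game forms under the misère convention (a player unable to move wins); $\overline{G}$ is the conjugate and $+$ the disjunctive sum. $o_L(G)$ (resp. $o_R(G)$) $\in\{\mathscr{L},\mathscr{R}\}$ denotes the winner when Left (resp. Right) moves first; $o(G)$ is the outcome class, ordered $\mathscr{L}>\mathscr{N}>\mathscr{R}$, $\mathscr{L}>\mathscr{P}>\mathscr{R}$. For a set of games $\mathcal{A}$, $G\geq_{\mathcal{A}}H$ iff $o(G+X)\geq o(H+X)$ for all $X\in\mathcal{A}$, and $\equiv_{\mathcal{A}}$ means both directions. A Left end is a game with no Left options. $0=\{\cdot\mid\cdot\}$, $1=\{0\mid\cdot\}$. Formal birthday is the height of the game tree. A universe is a set $\mathcal{U}$ of games closed under sums, conjugates, options, and formation of $\{\mathscr{G}\mid\mathscr{H}\}$ for finite non-empty $\mathscr{G},\mathscr{H}\subseteq\mathcal{U}$. $G\in\mathcal{U}$ is $\mathcal{U}$-invertible if $G+H\equiv_{\mathcal{U}}0$ for some $H\in\mathcal{U}$. A game $G$ is a disintegrator if there is a Right option $G^R$ that is not a Left end such that every Left option $G^{RL}$ of $G^R$ satisfies $o_L(G^{RL})=\mathscr{R}$ or is itself a disintegrator (recursive definition). A game $G$ is a starkiller if there is a Right option $G^R$ with $o_R(G^R)=\mathscr{R}$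 such that every Left option $G^{RL}$ of $G^R$ satisfies $o_L(G^{RL})=\mathscr{R}$ or is itself a starkiller. -}

module Defs where

open import Data.Nat using (ℕ; zero; suc; _⊔_)
open import Data.List using (List; []; _∷_; _++_)
open import Data.List.Membership.Propositional using (_∈_)
open import Data.List.Relation.Unary.All using (All)
open import Data.Product using (Σ; ∃; _×_; _,_)
open import Data.Sum using (_⊎_)
open import Relation.Binary.PropositionalEquality using (_≡_)
open import Relation.Nullary using (¬_)

-- Short partizan game forms: a form is given by its lists of Left and
-- Right options.  (Option *sets* are represented by lists; identity of
-- forms up to order/repetition of options is the relation _≅_ below.)

data Game : Set where
  ⟨_∣_⟩ : List Game → List Game → Game

lefts : Game → List Game
lefts ⟨ ls ∣ _ ⟩ = ls

rights : Game → List Game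
rights ⟨ _ ∣ rs ⟩ = rs

0G : Game
0G = ⟨ [] ∣ [] ⟩

1G : Game
1G = ⟨ 0G ∷ [] ∣ [] ⟩

data _≅_ : Game → Game → Set where
  form≅ : ∀ {G H} →
    (∀ {x} → x ∈ lefts G → Σ Game λ y → y ∈ lefts H × x ≅ y) →
    (∀ {y} → y ∈ lefts H → Σ Game λ x → x ∈ lefts G × x ≅ y) →
    (∀ {x} → x ∈ rights G → Σ Game λ y → y ∈ rights H × x ≅ y) →
    (∀ {y} → y ∈ rights H → Σ Game λ x → x ∈ rights G × x ≅ y) →
    G ≅ H

mutual
  conj : Game → Game
  conj ⟨ ls ∣ rs ⟩ = ⟨ conjs rs ∣ conjs ls ⟩

  conjs : List Game → List Game
  conjs [] = []
  conjs (x ∷ xs) = conj x ∷ conjs xs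

mutual
  _+G_ : Game → Game → Game
  ⟨ ls ∣ rs ⟩ +G ⟨ ls′ ∣ rs′ ⟩ =
    ⟨ plusL ls ⟨ ls′ ∣ rs′ ⟩ ++ plusR ⟨ ls ∣ rs ⟩ ls′
    ∣ plusL rs ⟨ ls′ ∣ rs′ ⟩ ++ plusR ⟨ ls ∣ rs ⟩ rs′ ⟩

  plusL : List Game → Game → List Game
  plusL [] H = []
  plusL (x ∷ xs) H = (x +G H) ∷ plusL xs H

  plusR : Game → List Game → List Game
  plusR G [] = []
  plusR G (y ∷ ys) = (G +G y) ∷ plusR G ys

infixl 6 _+G_

data Player : Set where
  Left Right : Player

mutual
  -- winner when Left moves first (a player unable to move wins)
  oL : Game → Player
  oL ⟨ [] ∣ _ ⟩ = Left
  oL ⟨ x ∷ xs ∣ _ ⟩ = leftSearch (x ∷ xs)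

  leftSearch : List Game → Player
  leftSearch [] = Right
  leftSearch (x ∷ xs) with oR x
  ... | Left = Left
  ... | Right = leftSearch xs

  oR : Game → Player
  oR ⟨ _ ∣ [] ⟩ = Right
  oR ⟨ _ ∣ x ∷ xs ⟩ = rightSearch (x ∷ xs)

  rightSearch : List Game → Player
  rightSearch [] = Left
  rightSearch (x ∷ xs) with oL x
  ... | Right = Right
  ... | Left = rightSearch xs

data Outcome : Set where
  𝓛 𝓝 𝓟 𝓡 : Outcome

outcome : Game → Outcome
outcome G with oL G | oR G
... | Left  | Left  = 𝓛
... | Left  | Right = 𝓝
... | Right | Left  = 𝓟
... | Right | Right = 𝓡

data _≤O_ : Outcome → Outcome → Set where
  refl≤ : ∀ {o} → o ≤O o
  𝓡≤ : ∀ {o} → 𝓡 ≤O o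
  ≤𝓛 : ∀ {o} → o ≤O 𝓛

_≥[_]_ : Game → (Game → Set) → Game → Set
G ≥[ A ] H = ∀ X → A X → outcome (H +G X) ≤O outcome (G +G X)

_≡[_]_ : Game → (Game → Set) → Game → Set
G ≡[ A ] H = (G ≥[ A ] H) × (H ≥[ A ] G)

NonEmpty : List Game → Set
NonEmpty xs = Σ Game λ x → x ∈ xs

record Universe (U : Game → Set) : Set₁ where
  field
    nonempty  : Σ Game U
    respect≅  : ∀ {G H} → G ≅ H → U G → U H
    sum-closed  : ∀ {G H} → U G → U H → U (G +G H)
    conj-closed : ∀ {G} → U G → U (conj G)
    left-closed  : ∀ {G x} → U G → x ∈ lefts G → U x
    right-closed : ∀ {G x} → U G → x ∈ rights G → U x
    form-closed : ∀ (ls rs : List Game) → NonEmpty ls → NonEmpty rs →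
                  All U ls → All U rs → U ⟨ ls ∣ rs ⟩

Invertible : (Game → Set) → Game → Set
Invertible U G = U G × Σ Game λ H → U H × ((G +G H) ≡[ U ] 0G)

mutual
  birthday : Game → ℕ
  birthday ⟨ [] ∣ [] ⟩ = 0
  birthday ⟨ ls ∣ rs ⟩ = suc (maxB ls ⊔ maxB rs)

  maxB : List Game → ℕ
  maxB [] = 0
  maxB (x ∷ xs) = birthday x ⊔ maxB xs

LeftEnd : Game → Set
LeftEnd G = lefts G ≡ []

data Disintegrator : Game → Set where
  disint : ∀ {G} (GR : Game) → GR ∈ rights G → ¬ LeftEnd GR →
    (∀ {GRL} → GRL ∈ lefts GR → oL GRL ≡ Right ⊎ Disintegrator GRL) →
    Disintegrator G

data Starkiller : Game → Set where
  stark : ∀ {G} (GR : Game) → GR ∈ rights G → oR GR ≡ Right →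
    (∀ {GRL} → GRL ∈ lefts GR → oL GRL ≡ Right ⊎ Starkiller GRL) →
    Starkiller G

{-# OPTIONS --safe #-}

-- Up to identity, the forms of birthday 1 are ⋆ = {0|0}, 1 and -1.  Playing ⋆ + X, Right wins moving
-- first exactly when oL X = Right or X is a starkiller; with -1 for ⋆ one gets the disintegrators.
-- Hence G + conj G ≡ 0 for G = ⋆ (resp. 1) iff no Left end is a starkiller (resp. disintegrator): away
-- from ends, mirroring works.
--
-- It remains to see that an inverse H of G forces 0 ≼ G + conj G.  By maintenance (if J ≼ 0, every
-- Left option of J has a Right option ≼ 0), every K with G + K ≼ 0 is ≼ conj G, by induction on K,
-- unless G = ⋆ and the induction meets a Left end.  If there is a Left end E with ⋆ + E ≼ 0, then H
-- lies below the Right end conj E; this end makes H + H ≼ 0, so that H ≼ ⋆ by cancellation.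
module Submission where

open import Defs
open import Data.Empty using (⊥; ⊥-elim)
open import Data.List using (List; []; _∷_; _++_; map)
open import Data.List.Membership.Propositional using (_∈_)
open import Data.List.Membership.Propositional.Properties
  using (∈-map⁺; ∈-map⁻; ∈-++⁺ˡ; ∈-++⁺ʳ; ∈-++⁻)
open import Data.List.Relation.Unary.All using (All; []; _∷_)
open import Data.List.Relation.Unary.Any using (here; there)
open import Data.Nat using (suc; _⊔_; _≤_)
open import Data.Nat.Properties using (m≤m⊔n; m≤n⊔m; n≤0⇒n≡0; suc-injective; ≤-trans; ≤-reflexive)
open import Data.Product using (Σ; ∃; _×_; _,_; proj₁; proj₂)
open import Data.Sum using (_⊎_; inj₁; inj₂; [_,_]′)
open import Function using (_∘_)
open import Function.Bundles using (_⇔_; mk⇔)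
open import Induction.WellFounded using (Acc; acc; WellFounded)
open import Relation.Binary.Construct.Closure.Transitive
  using (TransClosure; [_]; _∷_; wellFounded)
open import Relation.Binary.PropositionalEquality
  using (_≡_; _≢_; refl; sym; trans; cong; cong₂; subst)
open import Relation.Nullary using (¬_; contradiction)

private
  variable
    G H K X x y g h : Game

-- The two players, treated symmetrically

opposite : Player → Player
opposite Left = Right
opposite Right = Left

options : Player → Game → List Game
options Left = lefts
options Right = rights

winner : Player → Game → Player
winner Left = oL
winner Right = oR

player-cases : ∀ p q → q ≡ p ⊎ q ≡ opposite p
player-cases Left Left = inj₁ refl
player-cases Left Right = inj₂ refl
player-cases Right Left = inj₂ refl
player-cases Right Right = inj₁ refl

clash : ∀ p {q} → q ≡ p → q ≡ opposite p → ⊥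
clash Left refl ()
clash Right refl ()

-- Since `_≼_` quantifies over all of `U`, options with a prescribed place in that order are found
-- only under double negation. Winners are decidable, so such options may still be used to determine
-- who wins.
Left-stable : ∀ {p} → ¬ ¬ (p ≡ Left) → p ≡ Left
Left-stable {Left} _ = refl
Left-stable {Right} n = ⊥-elim (n λ ())

¬Left⇒Right : ∀ {p} → p ≢ Left → p ≡ Right
¬Left⇒Right {Left} n = ⊥-elim (n refl)
¬Left⇒Right {Right} _ = refl

-- Outcomes

leftSearch-wins : ∀ {xs} → x ∈ xs → oR x ≡ Left → leftSearch xs ≡ Left
leftSearch-wins {xs = x ∷ xs} (here refl) e rewrite e = refl
leftSearch-wins {xs = x ∷ xs} (there m) e with oR x
... | Left = refl
... | Right = leftSearch-wins m e

rightSearch-wins : ∀ {xs} → x ∈ xs → oL x ≡ Right → rightSearch xs ≡ Right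
rightSearch-wins {xs = x ∷ xs} (here refl) e rewrite e = refl
rightSearch-wins {xs = x ∷ xs} (there m) e with oL x
... | Right = refl
... | Left = rightSearch-wins m e

leftSearch-finds : ∀ xs → leftSearch xs ≡ Left → ∃ λ x → x ∈ xs × oR x ≡ Left
leftSearch-finds (x ∷ xs) e with oR x in eq
... | Left = x , here refl , eq
... | Right with leftSearch-finds xs e
...   | y , m , f = y , there m , f

rightSearch-finds : ∀ xs → rightSearch xs ≡ Right → ∃ λ x → x ∈ xs × oL x ≡ Right
rightSearch-finds (x ∷ xs) e with oL x in eq
... | Right = x , here refl , eq
... | Left with rightSearch-finds xs e
...   | y , m , f = y , there m , f

wins-end : ∀ p {G} → options p G ≡ [] → winner p G ≡ p
wins-end Left {⟨ [] ∣ _ ⟩} refl = refl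
wins-end Right {⟨ _ ∣ [] ⟩} refl = refl

wins-by : ∀ p {G x} → x ∈ options p G → winner (opposite p) x ≡ p → winner p G ≡ p
wins-by Left {⟨ _ ∷ _ ∣ _ ⟩} m e = leftSearch-wins m e
wins-by Right {⟨ _ ∣ _ ∷ _ ⟩} m e = rightSearch-wins m e

wins⁻ : ∀ p {G} → winner p G ≡ p →
  options p G ≡ [] ⊎ (∃ λ x → x ∈ options p G × winner (opposite p) x ≡ p)
wins⁻ Left {⟨ [] ∣ _ ⟩} _ = inj₁ refl
wins⁻ Left {⟨ x ∷ xs ∣ _ ⟩} e = inj₂ (leftSearch-finds (x ∷ xs) e)
wins⁻ Right {⟨ _ ∣ [] ⟩} _ = inj₁ refl
wins⁻ Right {⟨ _ ∣ x ∷ xs ⟩} e = inj₂ (rightSearch-finds (x ∷ xs) e)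

loses⁻ : ∀ p {G x} → winner p G ≡ opposite p → x ∈ options p G → winner (opposite p) x ≡ opposite p
loses⁻ p {x = x} e m with player-cases p (winner (opposite p) x)
... | inj₁ w = ⊥-elim (clash p (wins-by p m w) e)
... | inj₂ w = w

loses : ∀ p {G} → options p G ≢ [] →
  (∀ {x} → x ∈ options p G → winner (opposite p) x ≡ opposite p) → winner p G ≡ opposite p
loses p {G} ne all with player-cases p (winner p G)
... | inj₂ l = l
... | inj₁ w with wins⁻ p w
...   | inj₁ e = contradiction e ne
...   | inj₂ (_ , m , v) = ⊥-elim (clash p v (all m))

-- Disjunctive sums

plusL-map : ∀ xs H → plusL xs H ≡ map (_+G H) xs
plusL-map [] H = refl
plusL-map (x ∷ xs) H = cong (x +G H ∷_) (plusL-map xs H)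

plusR-map : ∀ G ys → plusR G ys ≡ map (G +G_) ys
plusR-map G [] = refl
plusR-map G (y ∷ ys) = cong (G +G y ∷_) (plusR-map G ys)

options-+ : ∀ p G H →
  options p (G +G H) ≡ map (_+G H) (options p G) ++ map (G +G_) (options p H)
options-+ Left G@(⟨ ls ∣ _ ⟩) H@(⟨ ls′ ∣ _ ⟩) = cong₂ _++_ (plusL-map ls H) (plusR-map G ls′)
options-+ Right G@(⟨ _ ∣ rs ⟩) H@(⟨ _ ∣ rs′ ⟩) = cong₂ _++_ (plusL-map rs H) (plusR-map G rs′)

data SumOption (p : Player) (G H : Game) : Game → Set where
  inˡ : g ∈ options p G → SumOption p G H (g +G H)
  inʳ : h ∈ options p H → SumOption p G H (G +G h)

∈-+ˡ : ∀ p {G H g} → g ∈ options p G → (g +G H) ∈ options p (G +G H)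
∈-+ˡ p {G} {H} m = subst (_ ∈_) (sym (options-+ p G H)) (∈-++⁺ˡ (∈-map⁺ (_+G H) m))

∈-+ʳ : ∀ p {G H h} → h ∈ options p H → (G +G h) ∈ options p (G +G H)
∈-+ʳ p {G} {H} m =
  subst (_ ∈_) (sym (options-+ p G H)) (∈-++⁺ʳ (map (_+G H) (options p G)) (∈-map⁺ (G +G_) m))

∈-+⁻ : ∀ p G H {x} → x ∈ options p (G +G H) → SumOption p G H x
∈-+⁻ p G H m with ∈-++⁻ (map (_+G H) (options p G)) (subst (_ ∈_) (options-+ p G H) m)
... | inj₁ n with ∈-map⁻ (_+G H) n
...   | _ , k , refl = inˡ k
∈-+⁻ p G H m | inj₂ n with ∈-map⁻ (G +G_) n
...   | _ , k , refl = inʳ k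

empty : ∀ {xs : List Game} → (∀ {x} → ¬ x ∈ xs) → xs ≡ []
empty {[]} _ = refl
empty {x ∷ xs} n = ⊥-elim (n (here refl))

∉-[] : ∀ {xs : List Game} → xs ≡ [] → ¬ x ∈ xs
∉-[] refl ()

sum-end : ∀ p G H → options p G ≡ [] → options p H ≡ [] → options p (G +G H) ≡ []
sum-end p G H eG eH = empty λ m → case-option (∈-+⁻ p G H m)
  where
  case-option : ∀ {x} → ¬ SumOption p G H x
  case-option (inˡ n) = ∉-[] eG n
  case-option (inʳ n) = ∉-[] eH n

data SumWin (p : Player) (G H : Game) : Set where
  bothEnds : options p G ≡ [] → options p H ≡ [] → SumWin p G H
  moveˡ : g ∈ options p G → winner (opposite p) (g +G H) ≡ p → SumWin p G H
  moveʳ : h ∈ options p H → winner (opposite p) (G +G h) ≡ p → SumWin p G H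

sum-wins⁻ : ∀ p G H → winner p (G +G H) ≡ p → SumWin p G H
sum-wins⁻ p G H w with wins⁻ p w
... | inj₁ e = bothEnds (empty (∉-[] e ∘ ∈-+ˡ p)) (empty (∉-[] e ∘ ∈-+ʳ p))
... | inj₂ (x , m , v) with ∈-+⁻ p G H m
...   | inˡ n = moveˡ n v
...   | inʳ n = moveʳ n v

sum-wins : ∀ p G H → SumWin p G H → winner p (G +G H) ≡ p
sum-wins p G H (bothEnds eG eH) = wins-end p (sum-end p G H eG eH)
sum-wins p _ _ (moveˡ m w) = wins-by p (∈-+ˡ p m) w
sum-wins p _ _ (moveʳ m w) = wins-by p (∈-+ʳ p m) w

sum-losesˡ : ∀ p G H {g} → winner p (G +G H) ≡ opposite p → g ∈ options p G →
  winner (opposite p) (g +G H) ≡ opposite p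
sum-losesˡ p _ _ l m = loses⁻ p l (∈-+ˡ p m)

sum-losesʳ : ∀ p G H {h} → winner p (G +G H) ≡ opposite p → h ∈ options p H →
  winner (opposite p) (G +G h) ≡ opposite p
sum-losesʳ p _ _ l m = loses⁻ p l (∈-+ʳ p m)

sum-loses : ∀ p G H → ¬ (options p G ≡ [] × options p H ≡ []) →
  (∀ {g} → g ∈ options p G → winner (opposite p) (g +G H) ≡ opposite p) →
  (∀ {h} → h ∈ options p H → winner (opposite p) (G +G h) ≡ opposite p) →
  winner p (G +G H) ≡ opposite p
sum-loses p G H ne l r with player-cases p (winner p (G +G H))
... | inj₂ e = e
... | inj₁ w with sum-wins⁻ p G H w
...   | bothEnds eG eH = contradiction (eG , eH) ne
...   | moveˡ m v = ⊥-elim (clash p v (l m))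
...   | moveʳ m v = ⊥-elim (clash p v (r m))

-- Well-founded induction on positions

_⊏_ : Game → Game → Set
x ⊏ G = ∃ λ p → x ∈ options p G

-- Reversals, starkillers and disintegrators all lead to an option of an option, so the inductions
-- have to descend by two moves at once.
_⊏⁺_ : Game → Game → Set
_⊏⁺_ = TransClosure _⊏_

mutual
  ⊏-wellFounded : WellFounded _⊏_
  ⊏-wellFounded ⟨ ls ∣ rs ⟩ = acc λ where
    (Left , m) → ⊏-accessible ls m
    (Right , m) → ⊏-accessible rs m

  ⊏-accessible : ∀ xs → x ∈ xs → Acc _⊏_ x
  ⊏-accessible (x ∷ _) (here refl) = ⊏-wellFounded x
  ⊏-accessible (_ ∷ xs) (there m) = ⊏-accessible xs m

⊏⁺-wellFounded : WellFounded _⊏⁺_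
⊏⁺-wellFounded = wellFounded _⊏_ ⊏-wellFounded

-- Identity of forms

Matches : (Game → Game → Set) → Game → Game → Set
Matches R G H = ∀ p →
  (∀ {x} → x ∈ options p G → ∃ λ y → y ∈ options p H × R x y) ×
  (∀ {y} → y ∈ options p H → ∃ λ x → x ∈ options p G × R x y)

-- One induction on `G` serves every such `R`, because matched options are related again. Each
-- identity of sums below then only needs a suitable relation.
bisimilar⇒≅ : (R : Game → Game → Set) → (∀ {G H} → R G H → Matches R G H) →
  R G H → G ≅ H
bisimilar⇒≅ {G} {H} R match = go G H (⊏-wellFounded G)
  where
  go : ∀ G H → Acc _⊏_ G → R G H → G ≅ H
  forth : ∀ G H → Acc _⊏_ G → R G H → ∀ p {x} → x ∈ options p G → ∃ λ y → y ∈ options p H × x ≅ y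
  back : ∀ G H → Acc _⊏_ G → R G H → ∀ p {y} → y ∈ options p H → ∃ λ x → x ∈ options p G × x ≅ y
  go G H a r = form≅ (forth G H a r Left) (back G H a r Left) (forth G H a r Right) (back G H a r Right)
  forth G H (acc rs) r p {x} m =
    let y , n , s = proj₁ (match r p) m in y , n , go x y (rs (p , m)) s
  back G H (acc rs) r p {y} n =
    let x , m , s = proj₂ (match r p) n in x , m , go x y (rs (p , m)) s

≅-matches : G ≅ H → Matches _≅_ G H
≅-matches (form≅ lf lb rf rb) Left = lf , lb
≅-matches (form≅ lf lb rf rb) Right = rf , rb

≅-sym : G ≅ H → H ≅ G
≅-sym = bisimilar⇒≅ (λ G H → H ≅ G) λ e p → proj₂ (≅-matches e p) , proj₁ (≅-matches e p)

≅-refl : G ≅ G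
≅-refl = bisimilar⇒≅ _≡_ (λ where refl p → (λ m → _ , m , refl) , (λ m → _ , m , refl)) refl

+-congʳ : ∀ X → G ≅ H → (G +G X) ≅ (H +G X)
+-congʳ X e = bisimilar⇒≅ R match (_ , _ , X , refl , refl , e)
  where
  R : Game → Game → Set
  R A B = ∃ λ G → ∃ λ H → ∃ λ X → A ≡ G +G X × B ≡ H +G X × G ≅ H
  match : ∀ {A B} → R A B → Matches R A B
  match (G , H , X , refl , refl , e) p = forth ∘ ∈-+⁻ p G X , back ∘ ∈-+⁻ p H X
    where
    forth : ∀ {x} → SumOption p G X x → ∃ λ y → y ∈ options p (H +G X) × R x y
    forth (inˡ m) = let y , n , f = proj₁ (≅-matches e p) m in
      y +G X , ∈-+ˡ p n , _ , _ , _ , refl , refl , f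
    forth (inʳ m) = _ , ∈-+ʳ p m , _ , _ , _ , refl , refl , e
    back : ∀ {y} → SumOption p H X y → ∃ λ x → x ∈ options p (G +G X) × R x y
    back (inˡ n) = let x , m , f = proj₂ (≅-matches e p) n in
      x +G X , ∈-+ˡ p m , _ , _ , _ , refl , refl , f
    back (inʳ m) = _ , ∈-+ʳ p m , _ , _ , _ , refl , refl , e

+-comm : ∀ G H → (G +G H) ≅ (H +G G)
+-comm G H = bisimilar⇒≅ R match (G , H , refl , refl)
  where
  R : Game → Game → Set
  R A B = ∃ λ G → ∃ λ H → A ≡ G +G H × B ≡ H +G G
  match : ∀ {A B} → R A B → Matches R A B
  match (G , H , refl , refl) p = forth ∘ ∈-+⁻ p G H , back ∘ ∈-+⁻ p H G
    where
    forth : ∀ {x} → SumOption p G H x → ∃ λ y → y ∈ options p (H +G G) × R x y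
    forth (inˡ m) = _ , ∈-+ʳ p m , _ , _ , refl , refl
    forth (inʳ m) = _ , ∈-+ˡ p m , _ , _ , refl , refl
    back : ∀ {y} → SumOption p H G y → ∃ λ x → x ∈ options p (G +G H) × R x y
    back (inˡ m) = _ , ∈-+ʳ p m , _ , _ , refl , refl
    back (inʳ m) = _ , ∈-+ˡ p m , _ , _ , refl , refl

+-assoc : ∀ G H K → ((G +G H) +G K) ≅ (G +G (H +G K))
+-assoc G H K = bisimilar⇒≅ R match (G , H , K , refl , refl)
  where
  R : Game → Game → Set
  R A B = ∃ λ G → ∃ λ H → ∃ λ K → A ≡ (G +G H) +G K × B ≡ G +G (H +G K)
  match : ∀ {A B} → R A B → Matches R A B
  match (G , H , K , refl , refl) p = forth ∘ ∈-+⁻ p (G +G H) K , back ∘ ∈-+⁻ p G (H +G K)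
    where
    forth : ∀ {x} → SumOption p (G +G H) K x → ∃ λ y → y ∈ options p (G +G (H +G K)) × R x y
    forth (inˡ m) with ∈-+⁻ p G H m
    ... | inˡ n = _ , ∈-+ˡ p n , _ , _ , _ , refl , refl
    ... | inʳ n = _ , ∈-+ʳ p (∈-+ˡ p n) , _ , _ , _ , refl , refl
    forth (inʳ m) = _ , ∈-+ʳ p (∈-+ʳ p m) , _ , _ , _ , refl , refl
    back : ∀ {y} → SumOption p G (H +G K) y → ∃ λ x → x ∈ options p ((G +G H) +G K) × R x y
    back (inˡ m) = _ , ∈-+ˡ p (∈-+ˡ p m) , _ , _ , _ , refl , refl
    back (inʳ m) with ∈-+⁻ p H K m
    ... | inˡ n = _ , ∈-+ˡ p (∈-+ʳ p n) , _ , _ , _ , refl , refl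
    ... | inʳ n = _ , ∈-+ʳ p n , _ , _ , _ , refl , refl

+-identityˡ : ∀ G → (0G +G G) ≅ G
+-identityˡ G = bisimilar⇒≅ (λ A B → A ≡ 0G +G B) match refl
  where
  0-options : ∀ p → options p 0G ≡ []
  0-options Left = refl
  0-options Right = refl
  match : ∀ {A B} → A ≡ 0G +G B → Matches (λ A B → A ≡ 0G +G B) A B
  match {B = B} refl p = forth ∘ ∈-+⁻ p 0G B , λ m → _ , ∈-+ʳ p m , refl
    where
    forth : ∀ {x} → SumOption p 0G B x → ∃ λ y → y ∈ options p B × x ≡ 0G +G y
    forth (inˡ m) = ⊥-elim (∉-[] (0-options p) m)
    forth (inʳ m) = _ , m , refl

-- Comparing outcomes

-- The outcome order taken apart into one implication for each starting player; `⊑⇒≤O` and `≤O⇒⊑`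
-- connect it with `_≤O_`.
record _⊑_ (G H : Game) : Set where
  constructor ⊑-intro
  field
    first : oL G ≡ Left → oL H ≡ Left
    second : oR G ≡ Left → oR H ≡ Left

open _⊑_

winner-resp-≅ : G ≅ H → ∀ p → winner p G ≡ winner p H
winner-resp-≅ {G} {H} e p = go G H (⊏-wellFounded G) e p
  where
  go : ∀ G H → Acc _⊏_ G → G ≅ H → ∀ p → winner p G ≡ winner p H
  go G H (acc rs) e p with ≅-matches e p | player-cases p (winner p G)
  go G H (acc rs) e p | f , b | inj₁ w = trans w (sym (transfer (wins⁻ p w)))
    where
    transfer : options p G ≡ [] ⊎ (∃ λ x → x ∈ options p G × winner (opposite p) x ≡ p) →
      winner p H ≡ p
    transfer (inj₁ end) = wins-end p (empty λ n → ∉-[] end (proj₁ (proj₂ (b n))))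
    transfer (inj₂ (x , m , v)) = let y , n , d = f m in
      wins-by p n (trans (sym (go x y (rs (p , m)) d (opposite p))) v)
  go G H (acc rs) e p | f , b | inj₂ l = trans l (sym (loses p
    (λ end → clash p (wins-end p (empty λ m → ∉-[] end (proj₁ (proj₂ (f m))))) l)
    (λ {y} n → let x , m , d = b n in
      trans (sym (go x y (rs (p , m)) d (opposite p))) (loses⁻ p l m))))

≅⇒⊑ : G ≅ H → G ⊑ H
≅⇒⊑ e = ⊑-intro (trans (sym (winner-resp-≅ e Left))) (trans (sym (winner-resp-≅ e Right)))

⊑-trans : G ⊑ H → H ⊑ K → G ⊑ K
⊑-trans a b = ⊑-intro (first b ∘ first a) (second b ∘ second a)

outcomeOf : Player → Player → Outcome
outcomeOf Left Left = 𝓛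
outcomeOf Left Right = 𝓝
outcomeOf Right Left = 𝓟
outcomeOf Right Right = 𝓡

outcome-outcomeOf : ∀ G → outcome G ≡ outcomeOf (oL G) (oR G)
outcome-outcomeOf G with oL G | oR G
... | Left | Left = refl
... | Left | Right = refl
... | Right | Left = refl
... | Right | Right = refl

outcomeOf-≤ : ∀ l r l′ r′ → (l ≡ Left → l′ ≡ Left) × (r ≡ Left → r′ ≡ Left) →
  outcomeOf l r ≤O outcomeOf l′ r′
outcomeOf-≤ Left Left l′ r′ (f , g) rewrite f refl | g refl = refl≤
outcomeOf-≤ Left Right l′ Left (f , g) rewrite f refl = ≤𝓛
outcomeOf-≤ Left Right l′ Right (f , g) rewrite f refl = refl≤
outcomeOf-≤ Right Left Left r′ (f , g) rewrite g refl = ≤𝓛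
outcomeOf-≤ Right Left Right r′ (f , g) rewrite g refl = refl≤
outcomeOf-≤ Right Right l′ r′ _ = 𝓡≤

outcomeOf-≤⁻ : ∀ l r l′ r′ → outcomeOf l r ≤O outcomeOf l′ r′ →
  (l ≡ Left → l′ ≡ Left) × (r ≡ Left → r′ ≡ Left)
outcomeOf-≤⁻ Right Right _ _ _ = (λ ()) , (λ ())
outcomeOf-≤⁻ _ _ Left Left _ = (λ _ → refl) , (λ _ → refl)
outcomeOf-≤⁻ Left Right Left Right _ = (λ _ → refl) , (λ ())
outcomeOf-≤⁻ Right Left Right Left _ = (λ ()) , (λ _ → refl)
outcomeOf-≤⁻ Left Left Left Right ()
outcomeOf-≤⁻ Left Left Right Left ()
outcomeOf-≤⁻ Left Left Right Right ()
outcomeOf-≤⁻ Left Right Right Left ()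
outcomeOf-≤⁻ Left Right Right Right ()
outcomeOf-≤⁻ Right Left Left Right ()
outcomeOf-≤⁻ Right Left Right Right ()

⊑⇒≤O : G ⊑ H → outcome G ≤O outcome H
⊑⇒≤O {G} {H} o rewrite outcome-outcomeOf G | outcome-outcomeOf H = outcomeOf-≤ _ _ _ _ (first o , second o)

≤O⇒⊑ : outcome G ≤O outcome H → G ⊑ H
≤O⇒⊑ {G} {H} o rewrite outcome-outcomeOf G | outcome-outcomeOf H =
  let f , s = outcomeOf-≤⁻ (oL G) (oR G) (oL H) (oR H) o in ⊑-intro f s

-- Conjugates

conjs-map : ∀ xs → conjs xs ≡ map conj xs
conjs-map [] = refl
conjs-map (x ∷ xs) = cong (conj x ∷_) (conjs-map xs)

conjs-++ : ∀ xs ys → conjs (xs ++ ys) ≡ conjs xs ++ conjs ys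
conjs-++ [] ys = refl
conjs-++ (x ∷ xs) ys = cong (conj x ∷_) (conjs-++ xs ys)

∈-conj : ∀ p {G x} → x ∈ options p G → conj x ∈ options (opposite p) (conj G)
∈-conj Left {⟨ ls ∣ _ ⟩} m = subst (_ ∈_) (sym (conjs-map ls)) (∈-map⁺ conj m)
∈-conj Right {⟨ _ ∣ rs ⟩} m = subst (_ ∈_) (sym (conjs-map rs)) (∈-map⁺ conj m)

mutual
  conj-involutive : ∀ G → conj (conj G) ≡ G
  conj-involutive ⟨ ls ∣ rs ⟩ = cong₂ ⟨_∣_⟩ (conjs-involutive ls) (conjs-involutive rs)

  conjs-involutive : ∀ xs → conjs (conjs xs) ≡ xs
  conjs-involutive [] = refl
  conjs-involutive (x ∷ xs) = cong₂ _∷_ (conj-involutive x) (conjs-involutive xs)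

∈-conj⁻ : ∀ G → x ∈ rights (conj G) → conj x ∈ lefts G
∈-conj⁻ {x} G m = subst (λ K → conj x ∈ lefts K) (conj-involutive G) (∈-conj Right {conj G} m)

mutual
  conj-+ : ∀ G H → conj (G +G H) ≡ conj G +G conj H
  conj-+ G@(⟨ ls ∣ rs ⟩) H@(⟨ ls′ ∣ rs′ ⟩) = cong₂ ⟨_∣_⟩
    (trans (conjs-++ (plusL rs H) _) (cong₂ _++_ (conjs-plusL rs H) (conjs-plusR G rs′)))
    (trans (conjs-++ (plusL ls H) _) (cong₂ _++_ (conjs-plusL ls H) (conjs-plusR G ls′)))

  conjs-plusL : ∀ xs H → conjs (plusL xs H) ≡ plusL (conjs xs) (conj H)
  conjs-plusL [] H = refl
  conjs-plusL (x ∷ xs) H = cong₂ _∷_ (conj-+ x H) (conjs-plusL xs H)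

  conjs-plusR : ∀ G ys → conjs (plusR G ys) ≡ plusR (conj G) (conjs ys)
  conjs-plusR G [] = refl
  conjs-plusR G (y ∷ ys) = cong₂ _∷_ (conj-+ G y) (conjs-plusR G ys)

mutual
  oL-conj : ∀ G → oL (conj G) ≡ opposite (oR G)
  oL-conj ⟨ ls ∣ [] ⟩ = refl
  oL-conj ⟨ ls ∣ x ∷ rs ⟩ = leftSearch-conjs (x ∷ rs)

  oR-conj : ∀ G → oR (conj G) ≡ opposite (oL G)
  oR-conj ⟨ [] ∣ rs ⟩ = refl
  oR-conj ⟨ x ∷ ls ∣ rs ⟩ = rightSearch-conjs (x ∷ ls)

  leftSearch-conjs : ∀ xs → leftSearch (conjs xs) ≡ opposite (rightSearch xs)
  leftSearch-conjs [] = refl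
  leftSearch-conjs (x ∷ xs) rewrite oR-conj x with oL x
  ... | Left = leftSearch-conjs xs
  ... | Right = refl

  rightSearch-conjs : ∀ xs → rightSearch (conjs xs) ≡ opposite (leftSearch xs)
  rightSearch-conjs [] = refl
  rightSearch-conjs (x ∷ xs) rewrite oL-conj x with oR x
  ... | Left = refl
  ... | Right = rightSearch-conjs xs

conj-antitone : G ⊑ H → conj H ⊑ conj G
conj-antitone {G} {H} a =
  ⊑-intro (flip (oL-conj H) (oL-conj G) (second a)) (flip (oR-conj H) (oR-conj G) (first a))
  where
  flip : ∀ {p q p′ q′} → p ≡ opposite q → p′ ≡ opposite q′ →
    (q′ ≡ Left → q ≡ Left) → p ≡ Left → p′ ≡ Left
  flip {q = q} {q′ = Right} a refl f e = refl
  flip {q = q} {q′ = Left} a refl f e with f refl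
  flip {q = q} {q′ = Left} refl refl f () | refl

sum-identityˡ : ∀ p G → winner p (0G +G G) ≡ winner p G
sum-identityˡ p G = winner-resp-≅ (+-identityˡ G) p

-- These are the forms of birthday at most 1.
AllZero : Game → Set
AllZero G = ∀ p {x} → x ∈ options p G → x ≡ 0G

-- The order modulo a universe

module _ {U : Game → Set} (universe : Universe U) where
  open Universe universe

  0∈U : U 0G
  0∈U = go (proj₁ nonempty) (⊏-wellFounded _) (proj₂ nonempty)
    where
    go : ∀ G → Acc _⊏_ G → U G → U 0G
    go ⟨ [] ∣ [] ⟩ _ u = u
    go ⟨ x ∷ _ ∣ _ ⟩ (acc rs) u = go x (rs (Left , here refl)) (left-closed u (here refl))
    go ⟨ [] ∣ x ∷ _ ⟩ (acc rs) u = go x (rs (Right , here refl)) (right-closed u (here refl))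

  infix 4 _≼_

  -- This is `H ≥[ U ] G`, with the sides exchanged.
  record _≼_ (G H : Game) : Set where
    constructor ≼-intro
    field
      adding : ∀ X → U X → (G +G X) ⊑ (H +G X)

  open _≼_

  ≼-trans : G ≼ H → H ≼ K → G ≼ K
  ≼-trans a b = ≼-intro λ X u → ⊑-trans (adding a X u) (adding b X u)

  ≅⇒≼ : G ≅ H → G ≼ H
  ≅⇒≼ e = ≼-intro λ X _ → ≅⇒⊑ (+-congʳ X e)

  ≼-+ʳ : U K → G ≼ H → (G +G K) ≼ (H +G K)
  ≼-+ʳ {K} {G} {H} uK a = ≼-intro λ X u →
    ⊑-trans (≅⇒⊑ (+-assoc G K X))
      (⊑-trans (adding a (K +G X) (sum-closed uK u)) (≅⇒⊑ (≅-sym (+-assoc H K X))))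

  ≼-+ˡ : U K → G ≼ H → (K +G G) ≼ (K +G H)
  ≼-+ˡ {K} {G} {H} uK a =
    ≼-trans (≅⇒≼ (+-comm K G)) (≼-trans (≼-+ʳ uK a) (≅⇒≼ (+-comm H K)))

  -- Conjugation reverses outcomes, and `U` is closed under it: the hypothesis is tested against
  -- `conj X`, and the result conjugated back.
  ≼-conj : G ≼ H → conj H ≼ conj G
  ≼-conj {G} {H} a = ≼-intro λ X u → subst (λ Y → (conj H +G Y) ⊑ (conj G +G Y)) (conj-involutive X)
    (subst (_⊑ (conj G +G conj (conj X))) (conj-+ H (conj X))
      (subst (conj (H +G conj X) ⊑_) (conj-+ G (conj X))
        (conj-antitone (adding a (conj X) (conj-closed u)))))

  ≼0⇒ : G ≼ 0G → U X → ∀ p → winner p (G +G X) ≡ Left → winner p X ≡ Left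
  ≼0⇒ {G} {X} a u Left w = trans (sym (sum-identityˡ Left X)) (first (adding a X u) w)
  ≼0⇒ {G} {X} a u Right w = trans (sym (sum-identityˡ Right X)) (second (adding a X u) w)

  ⇒≼0 : (∀ X → U X → (oL (G +G X) ≡ Left → oL X ≡ Left) × (oR (G +G X) ≡ Left → oR X ≡ Left)) →
    G ≼ 0G
  ⇒≼0 a = ≼-intro λ X u → ⊑-intro
    (trans (sum-identityˡ Left X) ∘ proj₁ (a X u))
    (trans (sum-identityˡ Right X) ∘ proj₂ (a X u))

  -- Separating games and maintenance

  test : List Game → Game → Game
  test As B = ⟨ 0G ∷ As ∣ B ∷ [] ⟩

  -- The Left option `0G` makes `form-closed` applicable even if `As` is empty. It is no help to
  -- Left in `test As B` alone, since Right, unable to move from `0G`, wins.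
  test∈U : ∀ {As B} → All U As → U B → U (test As B)
  test∈U uAs uB = form-closed _ _ (_ , here refl) (_ , here refl) (0∈U ∷ uAs) (uB ∷ [])

  Answered : List Game → List Game → Set
  Answered xs As = ∀ {x} → x ∈ xs → ∃ λ A → A ∈ As × oR (x +G A) ≡ Left

  -- Left answers a move of Right in `x` by moving from `test As B` to the matching member of `As`;
  -- Right's only other move, to `B`, is met by the last hypothesis.
  test-wins : ∀ x {As B} → Answered (rights x) As → oL (x +G B) ≡ Left →
    oR (x +G test As B) ≡ Left
  test-wins x {As} {B} answers w = sum-loses Right x (test As B) (λ ())
    (λ {y} m → let A , n , v = answers m in sum-wins Left y (test As B) (moveʳ (there n) v))
    (λ where (here refl) → w)

  answered-∷ : ∀ {x xs A As} → oR (x +G A) ≡ Left → Answered xs As → Answered (x ∷ xs) (A ∷ As)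
  answered-∷ w _ (here refl) = _ , here refl , w
  answered-∷ _ ws (there m) = let B , n , v = ws m in B , there n , v

  mutual
    -- A winning strategy for Left is built into `A`. Its Left options contain adjoints of the Right
    -- options of `x`, ready as replies. Its one Right option `B` must be a win for Left moving
    -- first in `x + B`: it is `0G` if `x` is a Left end, as Left then has no move at all, and
    -- otherwise an adjoint of a Left option of `x`.
    adjoint : ∀ x → ∃ λ A → U A × oR (x +G A) ≡ Left
    adjoint ⟨ ls ∣ rs ⟩ with adjoints rs | answer ⟨ ls ∣ rs ⟩
    ... | As , uAs , ws | B , uB , w = test As B , test∈U uAs uB , test-wins ⟨ ls ∣ rs ⟩ ws w

    adjoints : ∀ xs → ∃ λ As → All U As × Answered xs As
    adjoints [] = [] , [] , λ ()
    adjoints (x ∷ xs) with adjoint x | adjoints xs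
    ... | A , u , w | As , us , ws = A ∷ As , u ∷ us , answered-∷ w ws

    answer : ∀ x → ∃ λ B → U B × oL (x +G B) ≡ Left
    answer ⟨ [] ∣ rs ⟩ = 0G , 0∈U , sum-wins Left ⟨ [] ∣ rs ⟩ 0G (bothEnds refl refl)
    answer ⟨ l ∷ ls ∣ rs ⟩ with adjoint l
    ... | B , u , w = B , u , sum-wins Left ⟨ l ∷ ls ∣ rs ⟩ B (moveˡ (here refl) w)

  Separator : Game → Set
  Separator y = ∃ λ X → U X × oR (y +G X) ≡ Left × oR X ≡ Right

  -- Turns a failure of `y ≼ 0G` with Left starting into one with Right starting. Right wins
  -- `test As X` by moving to `X`; in `y + test As X` that move loses, and the adjoints in `As`
  -- answer the moves in `y`.
  separator-from-oL : ∀ y {X} → U X → oL (y +G X) ≡ Left → oL X ≡ Right → Separator y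
  separator-from-oL y {X} u w l with adjoints (rights y)
  ... | As , uAs , ws =
    test As X , test∈U uAs u , test-wins y ws w , wins-by Right {test As X} (here refl) l

  separator : ¬ (y ≼ 0G) → ¬ ¬ Separator y
  separator {y} n none = n (⇒≼0 λ X u →
    (λ w → Left-stable λ l → none (separator-from-oL y u w (¬Left⇒Right l))) ,
    (λ w → Left-stable λ l → none (X , u , w , ¬Left⇒Right l)))

  Separators : List Game → Set
  Separators ys = ∃ λ Xs → All U Xs × (∀ {X} → X ∈ Xs → oR X ≡ Right) × Answered ys Xs

  separators : ∀ ys → (∀ {y} → y ∈ ys → ¬ (y ≼ 0G)) → ¬ ¬ Separators ys
  separators [] _ k = k ([] , [] , (λ ()) , λ ())
  separators (y ∷ ys) n k = separator (n (here refl)) λ where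
    (X , u , w , l) → separators ys (n ∘ there) λ where
      (Xs , us , ls , ws) → k (X ∷ Xs , u ∷ us ,
        (λ where
          (here refl) → l
          (there m) → ls m) ,
        answered-∷ w ws)

  -- Otherwise Left wins G + T but loses T, moving first, where T offers Left the separators of the
  -- Right options of x and offers Right a B with oL (x + B) = Left.
  maintenance : G ≼ 0G → x ∈ lefts G → ¬ ¬ ∃ λ y → y ∈ rights x × y ≼ 0G
  maintenance {G} {x} a m none = separators (rights x) (λ n b → none (_ , n , b)) refute
    where
    refute : ¬ Separators (rights x)
    refute (Xs , uXs , ls , ws) with answer x
    ... | B , uB , w = clash Left
      (≼0⇒ a (test∈U uXs uB) Left (sum-wins Left G (test Xs B) (moveˡ m (test-wins x ws w))))
      (loses Left {test Xs B} (λ ()) λ where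
        (here refl) → refl
        (there n) → ls n)

  ≼0-+ : U H → G ≼ 0G → H ≼ 0G → (G +G H) ≼ 0G
  ≼0-+ uH a b = ≼-trans (≼-+ʳ uH a) (≼-trans (≅⇒≼ (+-identityˡ _)) b)

  -- `K = 0 + K ≼ (G + H) + K = H + (G + K) ≼ H + 0 = H`.
  cancel : U H → U K → 0G ≼ (G +G H) → (G +G K) ≼ 0G → K ≼ H
  cancel {H} {K} {G} uH uK a b =
    ≼-trans (≅⇒≼ (≅-sym (+-identityˡ K)))
      (≼-trans (≼-+ʳ uK a)
        (≼-trans (≼-+ʳ uK (≅⇒≼ (+-comm G H)))
          (≼-trans (≅⇒≼ (+-assoc H G K))
            (≼-trans (≼-+ˡ uH b)
              (≼-trans (≅⇒≼ (+-comm H 0G)) (≅⇒≼ (+-identityˡ H)))))))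

  -- Inverses and the forms below them

  record Inverse (G H : Game) : Set where
    field
      inverse∈U : U H
      ≼0 : (G +G H) ≼ 0G
      0≼ : 0G ≼ (G +G H)

  open Inverse

  invertible⇒ : Invertible U G → ∃ (Inverse G)
  invertible⇒ (_ , H , uH , ge , le) = H , record
    { inverse∈U = uH
    ; ≼0 = ≼-intro λ X u → ≤O⇒⊑ (le X u)
    ; 0≼ = ≼-intro λ X u → ≤O⇒⊑ (ge X u)
    }

  ⇒invertible : U G → Inverse G H → Invertible U G
  ⇒invertible {H = H} uG i = uG , H , inverse∈U i ,
    (λ X u → ⊑⇒≤O (adding (0≼ i) X u)) , (λ X u → ⊑⇒≤O (adding (≼0 i) X u))

  inverse-≅ : G ≅ K → Inverse G H → Inverse K H
  inverse-≅ {H = H} e i = record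
    { inverse∈U = inverse∈U i
    ; ≼0 = ≼-trans (≅⇒≼ (+-congʳ H (≅-sym e))) (≼0 i)
    ; 0≼ = ≼-trans (0≼ i) (≅⇒≼ (+-congʳ H e))
    }

  ≼0-conj : ∀ G H → (G +G H) ≼ 0G → 0G ≼ (conj G +G conj H)
  ≼0-conj G H a = subst (0G ≼_) (conj-+ G H) (≼-conj a)

  0≼-conj : ∀ G H → 0G ≼ (G +G H) → (conj G +G conj H) ≼ 0G
  0≼-conj G H a = subst (_≼ 0G) (conj-+ G H) (≼-conj a)

  inverse-conj : Inverse G H → Inverse (conj G) (conj H)
  inverse-conj {G} {H} i = record
    { inverse∈U = conj-closed (inverse∈U i)
    ; ≼0 = 0≼-conj G H (0≼ i)
    ; 0≼ = ≼0-conj G H (≼0 i)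
    }

  -- Left answers a move to 0 in one of G and its conjugate by the same move in the other.
  0≼G-G : AllZero G → (∀ {X} → U X → LeftEnd X → oL ((G +G conj G) +G X) ≡ Left) →
    0G ≼ (G +G conj G)
  0≼G-G {G} zero end = ≼-intro λ X u → let a = go X (⊏-wellFounded X) u in
    ⊑-intro (first a ∘ trans (sym (sum-identityˡ Left X)))
            (second a ∘ trans (sym (sum-identityˡ Right X)))
    where
    S : Game
    S = G +G conj G

    reply : ∀ {y X} → SumOption Right G (conj G) y → oR X ≡ Left → oL (y +G X) ≡ Left
    reply {X = X} (inˡ {g} m) w with zero Right m
    ... | refl = sum-wins Left (0G +G conj G) X
      (moveˡ (∈-+ʳ Left {0G} {conj G} (∈-conj Right {G} m)) (trans (sum-identityˡ Right X) w))
    reply {X = X} (inʳ {h} m) w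
      with zero Left (∈-conj⁻ G m)
    ... | e with trans (sym (conj-involutive h)) (cong conj e)
    ...   | refl = sum-wins Left (G +G 0G) X
      (moveˡ (∈-+ˡ Left {G} {0G} (∈-conj⁻ G m))
        (trans (sum-identityˡ Right X) w))

    go : ∀ X → Acc _⊏_ X → U X → X ⊑ (S +G X)
    go X (acc rs) u = ⊑-intro as-first as-second
      where
      as-first : oL X ≡ Left → oL (S +G X) ≡ Left
      as-first w with wins⁻ Left {X} w
      -- Left wins `X` for want of a move, but may still have moves in `S`; there is no move to
      -- imitate, so this case is the hypothesis.
      ... | inj₁ e = end u e
      ... | inj₂ (x , m , v) =
        sum-wins Left S X (moveʳ m (second (go x (rs (Left , m)) (left-closed u m)) v))
      as-second : oR X ≡ Left → oR (S +G X) ≡ Left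
      as-second w = sum-loses Right S X
        (λ (_ , e) → clash Right (wins-end Right {X} e) w)
        (λ m → reply (∈-+⁻ Right G (conj G) m) w)
        (λ {x} m → first (go x (rs (Right , m)) (right-closed u m)) (loses⁻ Right {X} w m))

  -- Conjugating `0G ≼ G + conj G` gives the opposite inequality, as the sum is its own conjugate up
  -- to order.
  conjugate-inverse : AllZero G → U G →
    (∀ {X} → U X → LeftEnd X → oL ((G +G conj G) +G X) ≡ Left) → Inverse G (conj G)
  conjugate-inverse {G} zero uG end = record
    { inverse∈U = conj-closed uG
    ; ≼0 = ≼-trans (≅⇒≼ (+-comm G (conj G)))
        (subst (λ K → (conj G +G K) ≼ 0G) (conj-involutive G) (0≼-conj G (conj G) positive))
    ; 0≼ = positive
    }
    where
    positive : 0G ≼ (G +G conj G)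
    positive = 0≼G-G zero end

  -- Given an inverse H of G, the forms K with G + K ≼ 0 are those with K ≼ H.
  Below : Game → Game → Set
  Below G K = U K × (G +G K) ≼ 0G

  module _ {G : Game} (zero : AllZero G) (0∈G : 0G ∈ lefts G) where

    -- Maintenance for Left's move of `G` to `0G`: what is left is `0G + K`, so the Right option
    -- obtained comes from `K`.
    below-right : Below G K → ¬ ¬ ∃ λ k → k ∈ rights K × k ≼ 0G
    below-right {K} (_ , a) none = maintenance a (∈-+ˡ Left {G} {K} 0∈G) λ (y , m , b) →
      strip (∈-+⁻ Right 0G K m) b
      where
      strip : SumOption Right 0G K y → ¬ (y ≼ 0G)
      strip (inʳ {k} m) b = none (k , m , ≼-trans (≅⇒≼ (≅-sym (+-identityˡ k))) b)

    -- Maintenance for Left's move of `K` to `x`: Right's reply is made either in `G`, leaving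
    -- `0G + x`, or in `x`, leaving `G + k`. The latter puts `k` below again, two moves further
    -- down.
    below-left : Below G K → x ∈ lefts K →
      ¬ ¬ ((0G ∈ rights G × x ≼ 0G) ⊎ ∃ λ k → k ∈ rights x × Below G k)
    below-left {K} {x} (u , a) m none = maintenance a (∈-+ʳ Left {G} {K} m) λ (y , n , b) →
      strip (∈-+⁻ Right G x n) b
      where
      strip : SumOption Right G x y → ¬ (y ≼ 0G)
      strip (inˡ n) b with zero Right n
      ... | refl = none (inj₁ (n , ≼-trans (≅⇒≼ (≅-sym (+-identityˡ x))) b))
      strip (inʳ {k} n) b = none (inj₂ (k , n , right-closed (left-closed u m) n , b))

    -- By `below-left`, a winning move of Left in `K` either goes to some `k ≼ 0G`, and then Left
    -- moves `conj G` to `0G` instead, or is reversed to a smaller form below, where the induction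
    -- applies. Right's move of `conj G` to `0G` is matched by `below-right`. If `K` and `X` are
    -- both Left ends, Left wins without a move to transfer; `end` covers this.
    below⇒≼conj : (∀ {K X} → Below G K → LeftEnd K → U X → LeftEnd X → oL (conj G +G X) ≡ Left) →
      Below G K → K ≼ conj G
    below⇒≼conj {K} end b = ≼-intro λ X u → go K X (⊏⁺-wellFounded K) (⊏-wellFounded X) b u
      where
      go : ∀ K X → Acc _⊏⁺_ K → Acc _⊏_ X → Below G K → U X → (K +G X) ⊑ (conj G +G X)
      go K X aK@(acc rsK) aX@(acc rsX) b u = ⊑-intro as-first as-second
        where
        as-first : oL (K +G X) ≡ Left → oL (conj G +G X) ≡ Left
        as-first w with sum-wins⁻ Left K X w
        ... | bothEnds eK eX = end b eK u eX
        ... | moveʳ {x} m v =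
          sum-wins Left (conj G) X (moveʳ m (second (go K x aK (rsX (Left , m)) b (left-closed u m)) v))
        ... | moveˡ {k} m v = Left-stable λ n → below-left b m λ where
          (inj₁ (0∈ , k≼0)) → n (sum-wins Left (conj G) X
            (moveˡ (∈-conj Right {G} 0∈) (trans (sum-identityˡ Right X) (≼0⇒ k≼0 u Right v))))
          (inj₂ (k′ , m′ , b′)) → n (first
            (go k′ X (rsK ((Right , m′) ∷ [ Left , m ])) aX b′ u)
            (sum-losesˡ Right k X v m′))
        as-second : oR (K +G X) ≡ Left → oR (conj G +G X) ≡ Left
        as-second w = sum-loses Right (conj G) X
          (λ (e , _) → ∉-[] e (∈-conj Left {G} 0∈G))
          to-X
          (λ {x} m → first (go K x aK (rsX (Right , m)) b (right-closed u m)) (sum-losesʳ Right K X w m))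
          where
          to-X : h ∈ rights (conj G) → oL (h +G X) ≡ Left
          to-X {h} m
            with trans (sym (conj-involutive h)) (cong conj (zero Left (∈-conj⁻ G m)))
          ... | refl = Left-stable λ n → below-right b λ (k , m′ , k≼0) →
            n (trans (sum-identityˡ Left X)
              (≼0⇒ k≼0 u Left (sum-losesˡ Right K X w m′)))

    -- A move of Left in one summand is either reversed to a form below, or goes to something
    -- `≼ 0G`; in the latter case `below-right` lets Right bring the other summand to something
    -- `≼ 0G` as well. The hypothesis treats Right ends `X`, which Right wins moving first.
    below-sum≼0 : (∀ {K₁ K₂ X} → Below G K₁ → Below G K₂ → U X → rights X ≡ [] →
        oR ((K₁ +G K₂) +G X) ≡ Right) →
      Below G H → Below G K → (H +G K) ≼ 0G
    below-sum≼0 {H} {K} end b₁ b₂ = ⇒≼0 λ X u →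
      let a = go H K X (⊏⁺-wellFounded H) (⊏⁺-wellFounded K) (⊏-wellFounded X) b₁ b₂ u in
      first a , second a
      where
      go : ∀ H K X → Acc _⊏⁺_ H → Acc _⊏⁺_ K → Acc _⊏_ X → Below G H → Below G K → U X →
        ((H +G K) +G X) ⊑ X
      go H K X aH@(acc rsH) aK@(acc rsK) aX@(acc rsX) bH bK u = ⊑-intro as-first as-second
        where
        move : SumOption Left H K y → oR (y +G X) ≡ Left → ¬ ¬ (oL X ≡ Left)
        move (inˡ {h} m) w n = below-left bH m λ where
          (inj₁ (_ , h≼0)) → below-right bK λ (k , m′ , k≼0) →
            n (≼0⇒ (≼0-+ (right-closed (proj₁ bK) m′) h≼0 k≼0) u Left
              (sum-losesˡ Right (h +G K) X w (∈-+ʳ Right {h} {K} m′)))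
          (inj₂ (h′ , m′ , b′)) → n (first
            (go h′ K X (rsH ((Right , m′) ∷ [ Left , m ])) aK aX b′ bK u)
            (sum-losesˡ Right (h +G K) X w (∈-+ˡ Right {h} {K} m′)))
        move (inʳ {k} m) w n = below-left bK m λ where
          (inj₁ (_ , k≼0)) → below-right bH λ (h , m′ , h≼0) →
            n (≼0⇒ (≼0-+ (left-closed (proj₁ bK) m) h≼0 k≼0) u Left
              (sum-losesˡ Right (H +G k) X w (∈-+ˡ Right {H} {k} m′)))
          (inj₂ (k′ , m′ , b′)) → n (first
            (go H k′ X aH (rsK ((Right , m′) ∷ [ Left , m ])) aX bH b′ u)
            (sum-losesˡ Right (H +G k) X w (∈-+ʳ Right {H} {k} m′)))
        as-first : oL ((H +G K) +G X) ≡ Left → oL X ≡ Left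
        as-first w with sum-wins⁻ Left (H +G K) X w
        ... | bothEnds _ e = wins-end Left {X} e
        ... | moveˡ m v = Left-stable (move (∈-+⁻ Left H K m) v)
        ... | moveʳ {x} m v =
          wins-by Left {X} m (second (go H K x aH aK (rsX (Left , m)) bH bK (left-closed u m)) v)
        as-second : oR ((H +G K) +G X) ≡ Left → oR X ≡ Left
        as-second w = loses Right {X}
          (λ e → clash Right (end bH bK u e) w)
          (λ {x} m → first (go H K x aH aK (rsX (Right , m)) bH bK (right-closed u m))
            (sum-losesʳ Right (H +G K) X w m))

-- Starkillers and disintegrators as wins for Right

⋆G -1G : Game
⋆G = ⟨ 0G ∷ [] ∣ 0G ∷ [] ⟩
-1G = conj 1G

allZero-⋆ : AllZero ⋆G
allZero-⋆ Left (here refl) = refl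
allZero-⋆ Right (here refl) = refl

allZero-1 : AllZero 1G
allZero-1 Left (here refl) = refl

-- Moving `⋆G` to `0G`, Right wins only if `oL X ≡ Right`. Moving `X` to `x`, Right has to survive
-- Left's replies `0G + x`, whence `oR x ≡ Right`, and `⋆G + y`, whence the recursion.
⋆+⇒starkiller : ∀ X → oR (⋆G +G X) ≡ Right → oL X ≡ Right ⊎ Starkiller X
⋆+⇒starkiller X = go X (⊏⁺-wellFounded X)
  where
  go : ∀ X → Acc _⊏⁺_ X → oR (⋆G +G X) ≡ Right → oL X ≡ Right ⊎ Starkiller X
  go X (acc rs) w with sum-wins⁻ Right ⋆G X w
  ... | moveˡ (here refl) v = inj₁ (trans (sym (sum-identityˡ Left X)) v)
  ... | moveʳ {x} m v = inj₂ (stark x m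
    (trans (sym (sum-identityˡ Right x)) (sum-losesˡ Left ⋆G x v (here refl)))
    (λ {y} n → go y (rs ((Left , n) ∷ [ Right , m ])) (sum-losesʳ Left ⋆G x v n)))

starkiller⇒⋆+ : Starkiller X → oR (⋆G +G X) ≡ Right
starkiller⇒⋆+ {X} (stark x m e f) = sum-wins Right ⋆G X (moveʳ m (sum-loses Left ⋆G x (λ ())
  (λ where (here refl) → trans (sum-identityˡ Right x) e)
  (λ n → go (f n))))
  where
  go : oL y ≡ Right ⊎ Starkiller y → oR (⋆G +G y) ≡ Right
  go {y} (inj₁ l) = sum-wins Right ⋆G y (moveˡ (here refl) (trans (sum-identityˡ Left y) l))
  go (inj₂ s) = starkiller⇒⋆+ s

-- As `-1G` has no Left option, Left would win `-1G + x` at once if `x` were a Left end; excluding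
-- this replaces the condition on `oR x`.
-1+⇒disintegrator : ∀ X → oR (-1G +G X) ≡ Right → oL X ≡ Right ⊎ Disintegrator X
-1+⇒disintegrator X = go X (⊏⁺-wellFounded X)
  where
  go : ∀ X → Acc _⊏⁺_ X → oR (-1G +G X) ≡ Right → oL X ≡ Right ⊎ Disintegrator X
  go X (acc rs) w with sum-wins⁻ Right -1G X w
  ... | moveˡ (here refl) v = inj₁ (trans (sym (sum-identityˡ Left X)) v)
  ... | moveʳ {x} m v = inj₂ (disint x m
    (λ e → clash Left (sum-wins Left -1G x (bothEnds refl e)) v)
    (λ {y} n → go y (rs ((Left , n) ∷ [ Right , m ])) (sum-losesʳ Left -1G x v n)))

disintegrator⇒-1+ : Disintegrator X → oR (-1G +G X) ≡ Right
disintegrator⇒-1+ {X} (disint x m ne f) = sum-wins Right -1G X (moveʳ m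
  (sum-loses Left -1G x (λ (_ , e) → ne e) (λ ()) (λ n → go (f n))))
  where
  go : oL y ≡ Right ⊎ Disintegrator y → oR (-1G +G y) ≡ Right
  go {y} (inj₁ l) = sum-wins Right -1G y (moveˡ (here refl) (trans (sum-identityˡ Left y) l))
  go (inj₂ d) = disintegrator⇒-1+ d

-- Forms of birthday 1

maxB-∈ : ∀ {xs} → x ∈ xs → birthday x ≤ maxB xs
maxB-∈ {xs = x ∷ xs} (here refl) = m≤m⊔n (birthday x) (maxB xs)
maxB-∈ {xs = x ∷ xs} (there m) = ≤-trans (maxB-∈ m) (m≤n⊔m (birthday x) (maxB xs))

birthday-0 : ∀ G → birthday G ≡ 0 → G ≡ 0G
birthday-0 ⟨ [] ∣ [] ⟩ _ = refl

birthday-suc : ∀ G {n} → birthday G ≡ suc n → maxB (lefts G) ⊔ maxB (rights G) ≡ n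
birthday-suc ⟨ [] ∣ _ ∷ _ ⟩ e = suc-injective e
birthday-suc ⟨ _ ∷ _ ∣ _ ⟩ e = suc-injective e

birthday-1⇒allZero : ∀ G → birthday G ≡ 1 → AllZero G
birthday-1⇒allZero G e p {x} m = birthday-0 x (n≤0⇒n≡0 (≤-trans (bound p m) (≤-reflexive (birthday-suc G e))))
  where
  bound : ∀ p → x ∈ options p G → birthday x ≤ maxB (lefts G) ⊔ maxB (rights G)
  bound Left m = ≤-trans (maxB-∈ m) (m≤m⊔n _ (maxB (rights G)))
  bound Right m = ≤-trans (maxB-∈ m) (m≤n⊔m (maxB (lefts G)) _)

allZero⇒≅ : AllZero G → AllZero H →
  (∀ p → 0G ∈ options p G → 0G ∈ options p H) → (∀ p → 0G ∈ options p H → 0G ∈ options p G) →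
  G ≅ H
allZero⇒≅ {G} {H} zG zH to from = form≅ (forth Left) (back Left) (forth Right) (back Right)
  where
  forth : ∀ p {x} → x ∈ options p G → ∃ λ y → y ∈ options p H × x ≅ y
  forth p m with zG p m
  ... | refl = 0G , to p m , ≅-refl
  back : ∀ p {y} → y ∈ options p H → ∃ λ x → x ∈ options p G × x ≅ y
  back p m with zH p m
  ... | refl = 0G , from p m , ≅-refl

-- Option lists may repeat `0G`, so there are three such forms only up to `_≅_`.
birthday-1 : ∀ G → birthday G ≡ 1 → G ≅ ⋆G ⊎ G ≅ 1G ⊎ G ≅ -1G
birthday-1 G@(⟨ ls ∣ rs ⟩) e with birthday-1⇒allZero G e
birthday-1 ⟨ [] ∣ _ ∷ _ ⟩ e | z with z Right (here refl)
... | refl = inj₂ (inj₂ (allZero⇒≅ z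
  (λ where Right (here refl) → refl)
  (λ where Right _ → here refl)
  (λ where Right _ → here refl)))
birthday-1 ⟨ _ ∷ _ ∣ [] ⟩ e | z with z Left (here refl)
... | refl = inj₂ (inj₁ (allZero⇒≅ z allZero-1
  (λ where Left _ → here refl)
  (λ where Left _ → here refl)))
birthday-1 ⟨ _ ∷ _ ∣ _ ∷ _ ⟩ e | z with z Left (here refl) | z Right (here refl)
... | refl | refl = inj₁ (allZero⇒≅ z allZero-⋆
  (λ where
    Left _ → here refl
    Right _ → here refl)
  (λ where
    Left _ → here refl
    Right _ → here refl))

-- Invertibility of star and of 1

module _ {U : Game → Set} (universe : Universe U) where
  open Universe universe

  private
    infix 4 _≼ᵁ_
    _≼ᵁ_ : Game → Game → Set
    _≼ᵁ_ = _≼_ universe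

    _⊙_ : G ≼ᵁ H → H ≼ᵁ K → G ≼ᵁ K
    _⊙_ = ≼-trans universe

  ⋆-inverse : (∀ G → U G → LeftEnd G → ¬ Starkiller G) → Inverse universe ⋆G ⋆G
  ⋆-inverse none = conjugate-inverse universe allZero-⋆
    (form-closed _ _ (_ , here refl) (_ , here refl) (0∈U universe ∷ []) (0∈U universe ∷ []))
    -- Both `conj ⋆G` and `0G +G ⋆G` compute to `⋆G`, so moving one star to `0G` leaves `⋆G +G X`.
    -- As `X` is a Left end, `oL X` is `Left`, and Right could win only with a starkiller.
    λ {X} u e → sum-wins Left (⋆G +G ⋆G) X (moveˡ (here refl) (Left-stable λ n →
      [ clash Left (wins-end Left {X} e) , none X u e ]′ (⋆+⇒starkiller X (¬Left⇒Right n))))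

  1-inverse : U 1G → (∀ G → U G → LeftEnd G → ¬ Disintegrator G) → Inverse universe 1G -1G
  1-inverse u1 none = conjugate-inverse universe allZero-1 u1
    λ {X} u e → sum-wins Left (1G +G -1G) X (moveˡ (here refl) (Left-stable λ n →
      [ clash Left (wins-end Left {X} e) , none X u e ]′ (-1+⇒disintegrator X (¬Left⇒Right n))))

  0≼⇒end-wins : 0G ≼ᵁ G → U X → LeftEnd X → oL (G +G X) ≡ Left
  0≼⇒end-wins {X = X} a u e = first (_≼_.adding a X u) (sum-wins Left 0G X (bothEnds refl e))

  -- Left wins the Left end `X` moving first, hence also `⋆G + ⋆G + X`; but each Left move there
  -- leaves `⋆G + X`, which Right wins if `X` is a starkiller.
  0≼⋆+⋆⇒no-starkiller : 0G ≼ᵁ (⋆G +G ⋆G) → U X → LeftEnd X → ¬ Starkiller X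
  0≼⋆+⋆⇒no-starkiller {X} a u e s with sum-wins⁻ Left (⋆G +G ⋆G) X (0≼⇒end-wins a u e)
  ... | moveˡ (here refl) v = clash Left v (starkiller⇒⋆+ s)
  ... | moveˡ (there (here refl)) v = clash Left v (starkiller⇒⋆+ s)
  ... | moveʳ m _ = ∉-[] e m

  0≼1-1⇒no-disintegrator : 0G ≼ᵁ (1G +G -1G) → U X → LeftEnd X → ¬ Disintegrator X
  0≼1-1⇒no-disintegrator {X} a u e d with sum-wins⁻ Left (1G +G -1G) X (0≼⇒end-wins a u e)
  ... | moveˡ (here refl) v = clash Left v (disintegrator⇒-1+ d)
  ... | moveʳ m _ = ∉-[] e m

  -- Since `-1G` has no Left option, the condition on ends in `below⇒≼conj` holds outright. So
  -- `H ≼ -1G`, and `0G ≼ 1G + H ≼ 1G + -1G`.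
  1-inverse⇒no-disintegrator : Inverse universe 1G H → U 1G → U X → LeftEnd X → ¬ Disintegrator X
  1-inverse⇒no-disintegrator {H} i u1 = 0≼1-1⇒no-disintegrator
    (Inverse.0≼ i ⊙ ≼-+ˡ universe u1 (below⇒≼conj universe allZero-1 (here refl)
      (λ {_} {X} _ _ _ e → sum-wins Left -1G X (bothEnds refl e))
      (Inverse.inverse∈U i , Inverse.≼0 i)))

  ⋆-self-inverse-without-ends : Inverse universe ⋆G H → U ⋆G →
    (∀ {K} → Below universe ⋆G K → ¬ LeftEnd K) → 0G ≼ᵁ (⋆G +G ⋆G)
  ⋆-self-inverse-without-ends i u⋆ none =
    Inverse.0≼ i ⊙ ≼-+ˡ universe u⋆ (below⇒≼conj universe allZero-⋆ (here refl)
      (λ b e → ⊥-elim (none b e))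
      (Inverse.inverse∈U i , Inverse.≼0 i))

  ⋆-self-inverse-with-end : ∀ {E} → Inverse universe ⋆G H → U ⋆G →
    Below universe ⋆G E → LeftEnd E → 0G ≼ᵁ (⋆G +G ⋆G)
  ⋆-self-inverse-with-end {H} {E} i u⋆ (uE , E≼) end =
    -- Here `cancel` has `H` as the common summand: `0G ≼ H + ⋆G` and `H + H ≼ 0G` give `H ≼ ⋆G`.
    0≼i ⊙ ≼-+ˡ universe u⋆ (cancel universe u⋆ uH (0≼i ⊙ ≅⇒≼ universe (+-comm ⋆G H)) H+H≼0)
    where
    uH : U H
    uH = Inverse.inverse∈U i
    0≼i : 0G ≼ᵁ (⋆G +G H)
    0≼i = Inverse.0≼ i
    E̅ : Game
    E̅ = conj E
    uE̅ : U E̅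
    uE̅ = conj-closed uE
    E̅-end : rights E̅ ≡ []
    E̅-end = empty λ {x} m → ∉-[] end (∈-conj⁻ E m)
    ≼E̅ : Below universe ⋆G K → K ≼ᵁ E̅
    -- Conjugating `E≼` gives `0G ≼ ⋆G + E̅`, because `⋆G` is its own conjugate.
    ≼E̅ (u , b) = cancel universe uE̅ u (≼0-conj universe ⋆G E E≼) b
    H+H≼0 : (H +G H) ≼ᵁ 0G
    H+H≼0 = below-sum≼0 universe allZero-⋆ (here refl)
      -- `K₁ + K₂ ≼ E̅ + E̅`, and when `X` is a Right end Right has no move in `E̅ + E̅ + X`, so
      -- wins it moving first.
      (λ {K₁} {K₂} {X} b₁ b₂ u e → ¬Left⇒Right λ w → clash Right
        (sum-wins Right (E̅ +G E̅) X (bothEnds (sum-end Right E̅ E̅ E̅-end E̅-end) e))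
        (second (_≼_.adding (≼-+ʳ universe (proj₁ b₂) (≼E̅ b₁) ⊙ ≼-+ˡ universe uE̅ (≼E̅ b₂)) X u) w))
      (uH , Inverse.≼0 i) (uH , Inverse.≼0 i)

  -- Whether a Left end lies below is not decidable, but the conclusion is a negation, so both cases
  -- may be refuted in turn.
  ⋆-inverse⇒no-starkiller : Inverse universe ⋆G H → U ⋆G → U X → LeftEnd X → ¬ Starkiller X
  ⋆-inverse⇒no-starkiller i u⋆ u e s = refute
    (⋆-self-inverse-without-ends i u⋆ λ b end → refute (⋆-self-inverse-with-end i u⋆ b end))
    where
    refute : ¬ (0G ≼ᵁ (⋆G +G ⋆G))
    refute a = 0≼⋆+⋆⇒no-starkiller a u e s

theorem4p10 : (U : Game → Set) → Universe U →
    (Σ Game λ G → Invertible U G × birthday G ≡ 1)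
    ⇔ ((∀ G → U G → LeftEnd G → ¬ Starkiller G)
    ⊎ (U 1G × (∀ G → U G → LeftEnd G → ¬ Disintegrator G)))
theorem4p10 U universe = mk⇔ to from
  where
  open Universe universe

  to : (Σ Game λ G → Invertible U G × birthday G ≡ 1) →
    (∀ G → U G → LeftEnd G → ¬ Starkiller G)
    ⊎ (U 1G × (∀ G → U G → LeftEnd G → ¬ Disintegrator G))
  to (G , inv , b) with invertible⇒ universe inv | birthday-1 G b
  ... | H , i | inj₁ e = inj₁ λ X u end →
    ⋆-inverse⇒no-starkiller universe (inverse-≅ universe e i) (respect≅ e (proj₁ inv)) u end
  ... | H , i | inj₂ (inj₁ e) = inj₂ (u1 , λ X u end →
    1-inverse⇒no-disintegrator universe (inverse-≅ universe e i) u1 u end)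
    where
    u1 : U 1G
    u1 = respect≅ e (proj₁ inv)
  -- `conj -1G` computes to `1G`, so conjugating the inverse pair reduces this case to the previous
  -- one.
  ... | H , i | inj₂ (inj₂ e) = inj₂ (u1 , λ X u end →
    1-inverse⇒no-disintegrator universe (inverse-conj universe (inverse-≅ universe e i)) u1 u end)
    where
    u1 : U 1G
    u1 = conj-closed (respect≅ e (proj₁ inv))

  from : (∀ G → U G → LeftEnd G → ¬ Starkiller G)
    ⊎ (U 1G × (∀ G → U G → LeftEnd G → ¬ Disintegrator G)) →
    Σ Game λ G → Invertible U G × birthday G ≡ 1
  from (inj₁ none) = ⋆G , ⇒invertible universe ⋆∈U (⋆-inverse universe none) , refl
    where
    ⋆∈U : U ⋆G
    ⋆∈U = Inverse.inverse∈U (⋆-inverse universe none)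
  from (inj₂ (u1 , none)) = 1G , ⇒invertible universe u1 (1-inverse universe u1 none) , refl
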